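{- Let $\mathbf{C}$ and $\mathbf{D}$ be categories, and let $T\colon \mathbf{C}\to\mathbf{C}$ be a varietor that preserves reflexive coequalizers. Then for every monadic functor $G\colon \mathbf{C}\to\mathbf{D}$, the composite $\mathbf{Alg}(T)\xrightarrow{U}\mathbf{C}\xrightarrow{G}\mathbf{D}$ is monadic, where $U$ is the forgetful functor.
   Context: For an endofunctor $T\colon\mathbf{C}\to\mathbf{C}$, the category $\mathbf{Alg}(T)$ has as objects pairs $(X, a\colon TX\to X)$ and as morphisms $(X,a)\to(Y,b)$ the morphisms $h\colon X\to Y$ of $\mathbf{C}$ with $h\circ a = b\circ Th$; the forgetful functor $U\colon \mathbf{Alg}(T)\to\mathbf{C}$ sends $(X,a)$ to $X$ and $h$ to $h$. $T$ is called a varietor if $U$ has a left adjoint. A reflexive coequalizer is a coequalizer of a parallel pair $f,g\colon X\to Y$ having a common section $s\colon Y\to X$ (i.e. $f\circ s=g\circ s=1_Y$); $T$ preserves reflexive coequalizers if it sends such coequalizers to coequalizers. -}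

module Defs where

open import Level using (Level; _⊔_; suc)
open import Data.Product using (Σ-syntax)
open import Relation.Binary.Structures using (IsEquivalence)
import Relation.Binary.Reasoning.Setoid as SetoidReasoning
open import Relation.Binary.Bundles using (Setoid)

private
  variable
    o ℓ e o′ ℓ′ e′ o″ ℓ″ e″ : Level

-- Hom-sets are setoids: "equal morphisms" always means _≈_.  Objects carry
-- no equality beyond _≡_, and nothing below compares objects for equality.
record Category (o ℓ e : Level) : Set (suc (o ⊔ ℓ ⊔ e)) where
  infix  4 _≈_ _⇒_
  infixr 9 _∘_
  field
    Obj : Set o
    _⇒_ : Obj → Obj → Set ℓ
    _≈_ : ∀ {A B} → A ⇒ B → A ⇒ B → Set e
    id  : ∀ {A} → A ⇒ A
    _∘_ : ∀ {A B C} → B ⇒ C → A ⇒ B → A ⇒ C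

    assoc     : ∀ {A B C D} {f : A ⇒ B} {g : B ⇒ C} {h : C ⇒ D} →
                (h ∘ g) ∘ f ≈ h ∘ (g ∘ f)
    identityˡ : ∀ {A B} {f : A ⇒ B} → id ∘ f ≈ f
    identityʳ : ∀ {A B} {f : A ⇒ B} → f ∘ id ≈ f
    equiv     : ∀ {A B} → IsEquivalence (_≈_ {A} {B})
    ∘-resp-≈  : ∀ {A B C} {f h : B ⇒ C} {g i : A ⇒ B} →
                f ≈ h → g ≈ i → f ∘ g ≈ h ∘ i

  module Equiv {A B : Obj} = IsEquivalence (equiv {A} {B})

  homSetoid : Obj → Obj → Setoid ℓ e
  homSetoid A B = record { Carrier = A ⇒ B ; _≈_ = _≈_ ; isEquivalence = equiv }

  module HomReasoning {A B : Obj} = SetoidReasoning (homSetoid A B)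

record Functor (C : Category o ℓ e) (D : Category o′ ℓ′ e′)
       : Set (o ⊔ ℓ ⊔ e ⊔ o′ ⊔ ℓ′ ⊔ e′) where
  private
    module C = Category C
    module D = Category D
  field
    F₀ : C.Obj → D.Obj
    F₁ : ∀ {A B} → A C.⇒ B → F₀ A D.⇒ F₀ B

    identity     : ∀ {A} → F₁ (C.id {A}) D.≈ D.id
    homomorphism : ∀ {X Y Z} {f : X C.⇒ Y} {g : Y C.⇒ Z} →
                   F₁ (g C.∘ f) D.≈ F₁ g D.∘ F₁ f
    F-resp-≈     : ∀ {A B} {f g : A C.⇒ B} → f C.≈ g → F₁ f D.≈ F₁ g

idF : {C : Category o ℓ e} → Functor C C
idF {C = C} = record
  { F₀           = λ X → X
  ; F₁           = λ f → f
  ; identity     = Equiv.refl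
  ; homomorphism = Equiv.refl
  ; F-resp-≈     = λ p → p
  }
  where open Category C

infixr 9 _∘F_

_∘F_ : {C : Category o ℓ e} {D : Category o′ ℓ′ e′} {E : Category o″ ℓ″ e″} →
       Functor D E → Functor C D → Functor C E
_∘F_ {E = E} G F = record
  { F₀           = λ X → G.F₀ (F.F₀ X)
  ; F₁           = λ f → G.F₁ (F.F₁ f)
  ; identity     = Equiv.trans (G.F-resp-≈ F.identity) G.identity
  ; homomorphism = Equiv.trans (G.F-resp-≈ F.homomorphism) G.homomorphism
  ; F-resp-≈     = λ p → G.F-resp-≈ (F.F-resp-≈ p)
  }
  where
    module F = Functor F
    module G = Functor G
    open Category E

record NaturalTransformation {C : Category o ℓ e} {D : Category o′ ℓ′ e′}
       (F G : Functor C D) : Set (o ⊔ ℓ ⊔ e ⊔ o′ ⊔ ℓ′ ⊔ e′) where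
  private
    module C = Category C
    module D = Category D
    module F = Functor F
    module G = Functor G
  field
    η       : ∀ X → F.F₀ X D.⇒ G.F₀ X
    commute : ∀ {X Y} (f : X C.⇒ Y) → η Y D.∘ F.F₁ f D.≈ G.F₁ f D.∘ η X

record NaturalIsomorphism {C : Category o ℓ e} {D : Category o′ ℓ′ e′}
       (F G : Functor C D) : Set (o ⊔ ℓ ⊔ e ⊔ o′ ⊔ ℓ′ ⊔ e′) where
  open Category D
  field
    F⇒G : NaturalTransformation F G
    F⇐G : NaturalTransformation G F
  module ⇒ = NaturalTransformation F⇒G
  module ⇐ = NaturalTransformation F⇐G
  field
    isoˡ : ∀ X → ⇐.η X ∘ ⇒.η X ≈ id
    isoʳ : ∀ X → ⇒.η X ∘ ⇐.η X ≈ id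

record IsEquivalenceOfCategories {C : Category o ℓ e} {D : Category o′ ℓ′ e′}
       (F : Functor C D) : Set (o ⊔ ℓ ⊔ e ⊔ o′ ⊔ ℓ′ ⊔ e′) where
  field
    F⁻¹      : Functor D C
    F∘F⁻¹≅id : NaturalIsomorphism (F ∘F F⁻¹) idF
    F⁻¹∘F≅id : NaturalIsomorphism (F⁻¹ ∘F F) idF

infix 5 _⊣_

record _⊣_ {C : Category o ℓ e} {D : Category o′ ℓ′ e′}
       (L : Functor C D) (R : Functor D C) : Set (o ⊔ ℓ ⊔ e ⊔ o′ ⊔ ℓ′ ⊔ e′) where
  private
    module C = Category C
    module D = Category D
    module L = Functor L
    module R = Functor R
  field
    unit   : NaturalTransformation idF (R ∘F L)
    counit : NaturalTransformation (L ∘F R) idF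
  module unit   = NaturalTransformation unit
  module counit = NaturalTransformation counit
  field
    zig : ∀ {A} → counit.η (L.F₀ A) D.∘ L.F₁ (unit.η A) D.≈ D.id
    zag : ∀ {B} → R.F₁ (counit.η B) C.∘ unit.η (R.F₀ B) C.≈ C.id

HasLeftAdjoint : {C : Category o ℓ e} {D : Category o′ ℓ′ e′} →
                 Functor D C → Set (o ⊔ ℓ ⊔ e ⊔ o′ ⊔ ℓ′ ⊔ e′)
HasLeftAdjoint {C = C} {D = D} R = Σ[ L ∈ Functor C D ] L ⊣ R

module _ {C : Category o ℓ e} (T : Functor C C) where
  open Category C
  private module T = Functor T

  record Algebra : Set (o ⊔ ℓ) where
    field
      carrier : Obj
      action  : T.F₀ carrier ⇒ carrier

  open Algebra

  record AlgebraMorphism (X Y : Algebra) : Set (ℓ ⊔ e) where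
    field
      arrow    : carrier X ⇒ carrier Y
      commutes : arrow ∘ action X ≈ action Y ∘ T.F₁ arrow

  open AlgebraMorphism

  Alg : Category (o ⊔ ℓ) (ℓ ⊔ e) e
  Alg = record
    { Obj       = Algebra
    ; _⇒_       = AlgebraMorphism
    ; _≈_       = λ h k → arrow h ≈ arrow k
    ; id        = λ {X} → record
      { arrow    = id
      ; commutes = begin
          id ∘ action X          ≈⟨ identityˡ ⟩
          action X               ≈⟨ identityʳ ⟨
          action X ∘ id          ≈⟨ ∘-resp-≈ Equiv.refl T.identity ⟨
          action X ∘ T.F₁ id     ∎
      }
    ; _∘_       = λ {X} {Y} {Z} h k → record
      { arrow    = arrow h ∘ arrow k
      ; commutes = begin
          (arrow h ∘ arrow k) ∘ action X                    ≈⟨ assoc ⟩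
          arrow h ∘ (arrow k ∘ action X)                    ≈⟨ ∘-resp-≈ Equiv.refl (commutes k) ⟩
          arrow h ∘ (action Y ∘ T.F₁ (arrow k))             ≈⟨ assoc ⟨
          (arrow h ∘ action Y) ∘ T.F₁ (arrow k)             ≈⟨ ∘-resp-≈ (commutes h) Equiv.refl ⟩
          (action Z ∘ T.F₁ (arrow h)) ∘ T.F₁ (arrow k)      ≈⟨ assoc ⟩
          action Z ∘ (T.F₁ (arrow h) ∘ T.F₁ (arrow k))      ≈⟨ ∘-resp-≈ Equiv.refl T.homomorphism ⟨
          action Z ∘ T.F₁ (arrow h ∘ arrow k)               ∎
      }
    ; assoc     = assoc
    ; identityˡ = identityˡ
    ; identityʳ = identityʳ
    ; equiv     = record { refl = Equiv.refl ; sym = Equiv.sym ; trans = Equiv.trans }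
    ; ∘-resp-≈  = ∘-resp-≈
    }
    where open HomReasoning

  Forgetful : Functor Alg C
  Forgetful = record
    { F₀           = carrier
    ; F₁           = arrow
    ; identity     = Equiv.refl
    ; homomorphism = Equiv.refl
    ; F-resp-≈     = λ p → p
    }

  IsVarietor : Set (o ⊔ ℓ ⊔ e)
  IsVarietor = HasLeftAdjoint Forgetful

module _ (C : Category o ℓ e) where
  open Category C

  record IsCoequalizer {X Y Q : Obj} (f g : X ⇒ Y) (q : Y ⇒ Q) : Set (o ⊔ ℓ ⊔ e) where
    field
      equality   : q ∘ f ≈ q ∘ g
      coequalize : ∀ {Z} (h : Y ⇒ Z) → h ∘ f ≈ h ∘ g → Q ⇒ Z
      universal  : ∀ {Z} {h : Y ⇒ Z} (eq : h ∘ f ≈ h ∘ g) → coequalize h eq ∘ q ≈ h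
      unique     : ∀ {Z} {h : Y ⇒ Z} (eq : h ∘ f ≈ h ∘ g) {u : Q ⇒ Z} →
                   u ∘ q ≈ h → u ≈ coequalize h eq

  record IsReflexivePair {X Y : Obj} (f g : X ⇒ Y) : Set (ℓ ⊔ e) where
    field
      section  : Y ⇒ X
      sectionˡ : f ∘ section ≈ id
      sectionʳ : g ∘ section ≈ id

PreservesReflexiveCoequalizers : {C : Category o ℓ e} {D : Category o′ ℓ′ e′} →
                                 Functor C D → Set (o ⊔ ℓ ⊔ e ⊔ o′ ⊔ ℓ′ ⊔ e′)
PreservesReflexiveCoequalizers {C = C} {D = D} F =
  ∀ {X Y Q} {f g : X ⇒ Y} {q : Y ⇒ Q} →
  IsReflexivePair C f g → IsCoequalizer C f g q →
  IsCoequalizer D (F₁ f) (F₁ g) (F₁ q)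
  where
    open Category C
    open Functor F

record Monad (C : Category o ℓ e) : Set (o ⊔ ℓ ⊔ e) where
  open Category C
  field
    F : Functor C C
    η : NaturalTransformation idF F
    μ : NaturalTransformation (F ∘F F) F
  module F = Functor F
  module η = NaturalTransformation η
  module μ = NaturalTransformation μ
  field
    assoc     : ∀ {X} → μ.η X ∘ F.F₁ (μ.η X) ≈ μ.η X ∘ μ.η (F.F₀ X)
    identityˡ : ∀ {X} → μ.η X ∘ F.F₁ (η.η X) ≈ id
    identityʳ : ∀ {X} → μ.η X ∘ η.η (F.F₀ X) ≈ id

module _ {C : Category o ℓ e} (M : Monad C) where
  open Category C
  private module M = Monad M

  record EMAlgebra : Set (o ⊔ ℓ ⊔ e) where
    field
      algebra : Algebra M.F
    open Algebra algebra public
    field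
      unitLaw  : action ∘ M.η.η carrier ≈ id
      assocLaw : action ∘ M.F.F₁ action ≈ action ∘ M.μ.η carrier

  open EMAlgebra

  -- The full subcategory of Alg M.F on the Eilenberg–Moore algebras.
  EilenbergMoore : Category (o ⊔ ℓ ⊔ e) (ℓ ⊔ e) e
  EilenbergMoore = record
    { Obj       = EMAlgebra
    ; _⇒_       = λ X Y → algebra X A.⇒ algebra Y
    ; _≈_       = A._≈_
    ; id        = A.id
    ; _∘_       = A._∘_
    ; assoc     = assoc
    ; identityˡ = identityˡ
    ; identityʳ = identityʳ
    ; equiv     = A.equiv
    ; ∘-resp-≈  = ∘-resp-≈
    }
    where module A = Category (Alg M.F)

module _ {C : Category o ℓ e} {D : Category o′ ℓ′ e′}
         {L : Functor C D} {R : Functor D C} (adj : L ⊣ R) where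
  private
    module C = Category C
    module D = Category D
    module L = Functor L
    module R = Functor R
  open _⊣_ adj

  private
    R-square : ∀ {W X Y Z} {f : X D.⇒ Z} {g : W D.⇒ X} {h : Y D.⇒ Z} {k : W D.⇒ Y} →
               f D.∘ g D.≈ h D.∘ k → R.F₁ f C.∘ R.F₁ g C.≈ R.F₁ h C.∘ R.F₁ k
    R-square p = C.Equiv.trans (C.Equiv.sym R.homomorphism)
                   (C.Equiv.trans (R.F-resp-≈ p) R.homomorphism)

  adjunctionMonad : Monad C
  adjunctionMonad = record
    { F         = R ∘F L
    ; η         = unit
    ; μ         = record
      { η       = λ X → R.F₁ (counit.η (L.F₀ X))
      ; commute = λ f → R-square (counit.commute (L.F₁ f))
      }
    ; assoc     = R-square (counit.commute (counit.η _))
    ; identityˡ = C.Equiv.trans (C.Equiv.sym R.homomorphism)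
                    (C.Equiv.trans (R.F-resp-≈ zig) R.identity)
    ; identityʳ = zag
    }

  comparison : Functor D (EilenbergMoore adjunctionMonad)
  comparison = record
    { F₀           = λ Y → record
      { algebra  = record { carrier = R.F₀ Y ; action = R.F₁ (counit.η Y) }
      ; unitLaw  = zag
      ; assocLaw = R-square (counit.commute (counit.η Y))
      }
    ; F₁           = λ f → record
      { arrow = R.F₁ f ; commutes = R-square (D.Equiv.sym (counit.commute f)) }
    ; identity     = R.identity
    ; homomorphism = R.homomorphism
    ; F-resp-≈     = R.F-resp-≈
    }

-- Monadic up to equivalence: the comparison functor has a quasi-inverse (it is
-- not required to be an isomorphism of categories).
record IsMonadic {C : Category o ℓ e} {D : Category o′ ℓ′ e′}
       (R : Functor D C) : Set (o ⊔ ℓ ⊔ e ⊔ o′ ⊔ ℓ′ ⊔ e′) where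
  field
    L             : Functor C D
    L⊣R           : L ⊣ R
    isEquivalence : IsEquivalenceOfCategories (comparison L⊣R)

{-# OPTIONS --safe #-}

-- Write F ⊣ U and L ⊣ G for the two adjunctions, K = F L and R = G U.  Since G
-- is monadic it is faithful, lifts algebra homomorphisms, and reflects split
-- coequalizers.  An algebra (X , a) for the monad R K restricts along
-- G η L : G L ⇒ G U F L to a G L-algebra, which is realized by an object Q of C;
-- the map a then lifts to q : U K X ⇒ Q, which is the coequalizer of the
-- reflexive, G-split pair U K a , U ε.  As T preserves this coequalizer, Q
-- inherits a T-algebra structure from K X, and R Q ≅ X as algebras.
-- Homomorphisms lift for the same reason: T sends the reflexive coequalizer
-- U ε : U K R A ⇒ U A to an epimorphism.
module Submission where

open import Defs
open import Level using (Level; _⊔_)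
open import Data.Product using (_,_)

private
  variable
    o ℓ e o′ ℓ′ e′ : Level

-- Morphism calculus, epimorphisms and split coequalizers.

module Morphisms (C : Category o ℓ e) where
  open Category C
  open Equiv
  open HomReasoning

  infixr 4 refl⟩∘⟨_
  infixl 5 _⟩∘⟨refl

  refl⟩∘⟨_ : ∀ {X Y Z} {f : Y ⇒ Z} {g h : X ⇒ Y} → g ≈ h → f ∘ g ≈ f ∘ h
  refl⟩∘⟨ p = ∘-resp-≈ refl p

  _⟩∘⟨refl : ∀ {X Y Z} {f g : Y ⇒ Z} {h : X ⇒ Y} → f ≈ g → f ∘ h ≈ g ∘ h
  p ⟩∘⟨refl = ∘-resp-≈ p refl

  extendʳ : ∀ {W X Y Z V} {f : X ⇒ Z} {g : W ⇒ X} {h : Y ⇒ Z} {k : W ⇒ Y} {x : V ⇒ W} →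
            f ∘ g ≈ h ∘ k → f ∘ (g ∘ x) ≈ h ∘ (k ∘ x)
  extendʳ p = trans (sym assoc) (trans (p ⟩∘⟨refl) assoc)

  extendˡ : ∀ {W X Y Z V} {f : X ⇒ Z} {g : W ⇒ X} {h : Y ⇒ Z} {k : W ⇒ Y} {x : Z ⇒ V} →
            f ∘ g ≈ h ∘ k → (x ∘ f) ∘ g ≈ (x ∘ h) ∘ k
  extendˡ p = trans assoc (trans (refl⟩∘⟨ p) (sym assoc))

  pullˡ : ∀ {W X Y Z} {f : Y ⇒ Z} {g : X ⇒ Y} {h : X ⇒ Z} {x : W ⇒ X} →
          f ∘ g ≈ h → f ∘ (g ∘ x) ≈ h ∘ x
  pullˡ p = trans (sym assoc) (p ⟩∘⟨refl)

  pullʳ : ∀ {W X Y Z} {f : X ⇒ Y} {g : W ⇒ X} {h : W ⇒ Y} {x : Y ⇒ Z} →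
          f ∘ g ≈ h → (x ∘ f) ∘ g ≈ x ∘ h
  pullʳ p = trans assoc (refl⟩∘⟨ p)

  cancelˡ : ∀ {X Y Z} {f : Y ⇒ Z} {g : Z ⇒ Y} {x : X ⇒ Z} → f ∘ g ≈ id → f ∘ (g ∘ x) ≈ x
  cancelˡ p = trans (pullˡ p) identityˡ

  cancelʳ : ∀ {X Y Z} {f : X ⇒ Y} {g : Y ⇒ X} {x : Y ⇒ Z} → f ∘ g ≈ id → (x ∘ f) ∘ g ≈ x
  cancelʳ p = trans (pullʳ p) identityʳ

  IsEpi : ∀ {X Y} → X ⇒ Y → Set (o ⊔ ℓ ⊔ e)
  IsEpi {Y = Y} q = ∀ {Z} {f g : Y ⇒ Z} → f ∘ q ≈ g ∘ q → f ≈ g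

  splitEpi⇒epi : ∀ {X Y} {q : X ⇒ Y} {s : Y ⇒ X} → q ∘ s ≈ id → IsEpi q
  splitEpi⇒epi s-section p =
    trans (sym (cancelʳ s-section)) (trans (p ⟩∘⟨refl) (cancelʳ s-section))

  coequalizer⇒epi : ∀ {X Y Q} {f g : X ⇒ Y} {q : Y ⇒ Q} → IsCoequalizer C f g q → IsEpi q
  coequalizer⇒epi {f = f} {g} {q} c {f = u} {v} p =
    trans (unique v∘q-equalizes p) (sym (unique v∘q-equalizes refl))
    where
      open IsCoequalizer c
      v∘q-equalizes : (v ∘ q) ∘ f ≈ (v ∘ q) ∘ g
      v∘q-equalizes = extendˡ equality

  record Iso (X Y : Obj) : Set (ℓ ⊔ e) where
    field
      to   : X ⇒ Y
      from : Y ⇒ X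
      isoˡ : from ∘ to ≈ id
      isoʳ : to ∘ from ≈ id

  Iso-refl : ∀ {X} → Iso X X
  Iso-refl = record { to = id ; from = id ; isoˡ = identityˡ ; isoʳ = identityˡ }

  -- The data are purely equational, so any functor preserves them. The two legs are not
  -- interchangeable: `t` splits `g`, which is later the counit leg of an algebra's canonical
  -- presentation.
  record IsSplitCoequalizer {X Y Q : Obj} (f g : X ⇒ Y) (q : Y ⇒ Q) : Set (ℓ ⊔ e) where
    field
      equality : q ∘ f ≈ q ∘ g
      s        : Q ⇒ Y
      t        : Y ⇒ X
      q∘s≈id   : q ∘ s ≈ id
      f∘t≈s∘q  : f ∘ t ≈ s ∘ q
      g∘t≈id   : g ∘ t ≈ id

    factor : ∀ {Z} {h : Y ⇒ Z} → h ∘ f ≈ h ∘ g → (h ∘ s) ∘ q ≈ h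
    factor {h = h} h∘f≈h∘g = begin
      (h ∘ s) ∘ q   ≈⟨ pullʳ (sym f∘t≈s∘q) ⟩
      h ∘ (f ∘ t)   ≈⟨ pullˡ h∘f≈h∘g ⟩
      (h ∘ g) ∘ t   ≈⟨ cancelʳ g∘t≈id ⟩
      h             ∎

-- Functors and equivalences of categories.

module _ {C : Category o ℓ e} {D : Category o′ ℓ′ e′} (F : Functor C D) where
  private
    module C = Category C
    module D = Category D
  open Functor F

  preserves-square : ∀ {W X Y Z} {f : X C.⇒ Z} {g : W C.⇒ X} {h : Y C.⇒ Z} {k : W C.⇒ Y} →
                     f C.∘ g C.≈ h C.∘ k → F₁ f D.∘ F₁ g D.≈ F₁ h D.∘ F₁ k
  preserves-square p =
    D.Equiv.trans (D.Equiv.sym homomorphism) (D.Equiv.trans (F-resp-≈ p) homomorphism)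

  preserves-triangle : ∀ {X Y Z} {f : Y C.⇒ Z} {g : X C.⇒ Y} {h : X C.⇒ Z} →
                       f C.∘ g C.≈ h → F₁ f D.∘ F₁ g D.≈ F₁ h
  preserves-triangle p = D.Equiv.trans (D.Equiv.sym homomorphism) (F-resp-≈ p)

  preserves-section : ∀ {X Y} {f : X C.⇒ Y} {g : Y C.⇒ X} →
                      f C.∘ g C.≈ C.id → F₁ f D.∘ F₁ g D.≈ D.id
  preserves-section p = D.Equiv.trans (preserves-triangle p) identity

  -- Compatibility of `lift` with `_≈_` follows from `F₁-lift` and `faithful`, so it is not a field.
  record IsFullyFaithful : Set (o ⊔ ℓ ⊔ e ⊔ o′ ⊔ ℓ′ ⊔ e′) where
    field
      faithful : ∀ {X Y} {f g : X C.⇒ Y} → F₁ f D.≈ F₁ g → f C.≈ g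
      lift     : ∀ {X Y} → F₀ X D.⇒ F₀ Y → X C.⇒ Y
      F₁-lift  : ∀ {X Y} (h : F₀ X D.⇒ F₀ Y) → F₁ (lift h) D.≈ h

  record IsSplitEssentiallySurjective : Set (o ⊔ ℓ ⊔ e ⊔ o′ ⊔ ℓ′ ⊔ e′) where
    field
      realize : D.Obj → C.Obj
      iso     : ∀ Y → Morphisms.Iso D (F₀ (realize Y)) Y

module _ {C : Category o ℓ e} (F : Functor C C) (F≅id : NaturalIsomorphism F idF) where
  open Category C
  open Equiv
  open Morphisms C
  open NaturalIsomorphism F≅id
  open Functor F

  conjugate : ∀ {X Y} (f : X ⇒ Y) → ⇒.η Y ∘ (F₁ f ∘ ⇐.η X) ≈ f
  conjugate {X} f = trans (pullˡ (⇒.commute f)) (cancelʳ (isoʳ X))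

  ≅id⇒faithful : ∀ {X Y} {f g : X ⇒ Y} → F₁ f ≈ F₁ g → f ≈ g
  ≅id⇒faithful {f = f} {g} p =
    trans (sym (conjugate f)) (trans (refl⟩∘⟨ p ⟩∘⟨refl) (conjugate g))

module _ {C : Category o ℓ e} {D : Category o′ ℓ′ e′} {F : Functor C D} where
  private
    module C = Category C
    module D = Category D
    module F = Functor F

  module _ (E : IsEquivalenceOfCategories F) where
    open IsEquivalenceOfCategories E
    private
      module F⁻¹ = Functor F⁻¹
      module Φ = NaturalIsomorphism F⁻¹∘F≅id
      module Ψ = NaturalIsomorphism F∘F⁻¹≅id
    open Morphisms C

    -- A functor isomorphic to the identity is faithful, which applies to both composites. The
    -- equation `F₁-lift` is therefore tested after applying `F ∘F F⁻¹`, with no appeal to triangle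
    -- identities: `lift h` is `F⁻¹.F₁ h` conjugated by `Φ`, and naturality of `Φ` undoes the
    -- conjugation.
    equivalence⇒fullyFaithful : IsFullyFaithful F
    equivalence⇒fullyFaithful = record
      { faithful = λ p → ≅id⇒faithful (F⁻¹ ∘F F) F⁻¹∘F≅id (F⁻¹.F-resp-≈ p)
      ; lift     = lift
      ; F₁-lift  = λ h → ≅id⇒faithful (F ∘F F⁻¹) F∘F⁻¹≅id (F.F-resp-≈ (F⁻¹F₁-lift h))
      }
      where
        open C
        open C.Equiv
        lift : ∀ {X Y} → F.F₀ X D.⇒ F.F₀ Y → X ⇒ Y
        lift {X} {Y} h = Φ.⇒.η Y ∘ (F⁻¹.F₁ h ∘ Φ.⇐.η X)

        F⁻¹F₁-lift : ∀ {X Y} (h : F.F₀ X D.⇒ F.F₀ Y) → F⁻¹.F₁ (F.F₁ (lift h)) ≈ F⁻¹.F₁ h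
        F⁻¹F₁-lift {X} {Y} h =
          trans (sym (cancelʳ (Φ.isoˡ X)))
            (trans (sym (Φ.⇐.commute (lift h)) ⟩∘⟨refl)
              (trans (cancelˡ (Φ.isoˡ Y) ⟩∘⟨refl) (cancelʳ (Φ.isoˡ X))))

    equivalence⇒splitEssentiallySurjective : IsSplitEssentiallySurjective F
    equivalence⇒splitEssentiallySurjective = record
      { realize = F⁻¹.F₀
      ; iso     = λ Y → record
        { to = Ψ.⇒.η Y ; from = Ψ.⇐.η Y ; isoˡ = Ψ.isoˡ Y ; isoʳ = Ψ.isoʳ Y }
      }

  -- The inverse conjugates a morphism by the chosen isomorphisms and lifts the result. Every
  -- equation in `C` is pushed into `D` by `faithful`, where `F₁-lift` removes the lifts and the
  -- isomorphisms cancel.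
  fullyFaithful∧splitEssentiallySurjective⇒equivalence :
    IsFullyFaithful F → IsSplitEssentiallySurjective F → IsEquivalenceOfCategories F
  fullyFaithful∧splitEssentiallySurjective⇒equivalence ff es = record
    { F⁻¹      = F⁻¹
    ; F∘F⁻¹≅id = record
      { F⇒G  = record
        { η       = to
        ; commute = λ h → trans (refl⟩∘⟨ F₁-lift _) (cancelˡ (isoʳ _))
        }
      ; F⇐G  = record
        { η       = from
        ; commute = λ h →
            trans (sym (cancelʳ (isoʳ _))) (trans assoc (sym (F₁-lift _)) ⟩∘⟨refl)
        }
      ; isoˡ = isoˡ
      ; isoʳ = isoʳ
      }
    ; F⁻¹∘F≅id = record
      { F⇒G  = record
        { η       = λ X → lift (to (F.F₀ X))
        ; commute = λ f → faithful (begin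
            F.F₁ (lift (to _) C.∘ lift _)         ≈⟨ F.homomorphism ⟩
            F.F₁ (lift (to _)) ∘ F.F₁ (lift _)    ≈⟨ ∘-resp-≈ (F₁-lift _) (F₁-lift _) ⟩
            to _ ∘ (from _ ∘ (F.F₁ f ∘ to _))     ≈⟨ cancelˡ (isoʳ _) ⟩
            F.F₁ f ∘ to _                         ≈⟨ refl⟩∘⟨ F₁-lift _ ⟨
            F.F₁ f ∘ F.F₁ (lift (to _))           ≈⟨ F.homomorphism ⟨
            F.F₁ (f C.∘ lift (to _))              ∎)
        }
      ; F⇐G  = record
        { η       = λ X → lift (from (F.F₀ X))
        ; commute = λ f → faithful (begin
            F.F₁ (lift (from _) C.∘ f)                ≈⟨ F.homomorphism ⟩
            F.F₁ (lift (from _)) ∘ F.F₁ f             ≈⟨ F₁-lift _ ⟩∘⟨refl ⟩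
            from _ ∘ F.F₁ f                           ≈⟨ refl⟩∘⟨ cancelʳ (isoʳ _) ⟨
            from _ ∘ ((F.F₁ f ∘ to _) ∘ from _)       ≈⟨ assoc ⟨
            (from _ ∘ (F.F₁ f ∘ to _)) ∘ from _       ≈⟨ ∘-resp-≈ (F₁-lift _) (F₁-lift _) ⟨
            F.F₁ (lift _) ∘ F.F₁ (lift (from _))      ≈⟨ F.homomorphism ⟨
            F.F₁ (lift _ C.∘ lift (from _))           ∎)
        }
      ; isoˡ = λ X → inverse (isoˡ (F.F₀ X))
      ; isoʳ = λ X → inverse (isoʳ (F.F₀ X))
      }
    }
    where
      open IsFullyFaithful ff
      open IsSplitEssentiallySurjective es
      open module Iso′ Y = Morphisms.Iso (iso Y)
      open Morphisms D
      open D
      open D.Equiv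
      open D.HomReasoning

      conj : ∀ {X Y} → X ⇒ Y → F.F₀ (realize X) ⇒ F.F₀ (realize Y)
      conj h = from _ ∘ (h ∘ to _)

      inverse : ∀ {X Y} {h : F.F₀ X ⇒ F.F₀ Y} {k : F.F₀ Y ⇒ F.F₀ X} →
                k ∘ h ≈ id → lift k C.∘ lift h C.≈ C.id
      inverse p = faithful (trans F.homomorphism
        (trans (∘-resp-≈ (F₁-lift _) (F₁-lift _)) (trans p (sym F.identity))))

      F⁻¹ : Functor D C
      F⁻¹ = record
        { F₀           = realize
        ; F₁           = λ h → lift (conj h)
        ; identity     = faithful (begin
            F.F₁ (lift (conj id))       ≈⟨ F₁-lift _ ⟩
            from _ ∘ (id ∘ to _)        ≈⟨ refl⟩∘⟨ identityˡ ⟩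
            from _ ∘ to _               ≈⟨ isoˡ _ ⟩
            id                          ≈⟨ F.identity ⟨
            F.F₁ C.id                   ∎)
        ; homomorphism = λ {_} {_} {_} {f} {g} → faithful (begin
            F.F₁ (lift (conj (g ∘ f)))                     ≈⟨ F₁-lift _ ⟩
            from _ ∘ ((g ∘ f) ∘ to _)                      ≈⟨ refl⟩∘⟨ assoc ⟩
            from _ ∘ (g ∘ (f ∘ to _))                      ≈⟨ refl⟩∘⟨ refl⟩∘⟨ cancelˡ (isoʳ _) ⟨
            from _ ∘ (g ∘ (to _ ∘ conj f))                 ≈⟨ refl⟩∘⟨ assoc ⟨
            from _ ∘ ((g ∘ to _) ∘ conj f)                 ≈⟨ assoc ⟨
            conj g ∘ conj f                                ≈⟨ ∘-resp-≈ (F₁-lift _) (F₁-lift _) ⟨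
            F.F₁ (lift (conj g)) ∘ F.F₁ (lift (conj f))    ≈⟨ F.homomorphism ⟨
            F.F₁ (lift (conj g) C.∘ lift (conj f))         ∎)
        ; F-resp-≈     = λ p → faithful
            (trans (F₁-lift _) (trans (refl⟩∘⟨ p ⟩∘⟨refl) (sym (F₁-lift _))))
        }

-- Reflection of split coequalizers.

module _ {C : Category o ℓ e} {D : Category o′ ℓ′ e′} {L : Functor D C} {G : Functor C D}
         (adj : L ⊣ G) (ff : IsFullyFaithful (comparison adj)) where
  private
    module C = Category C
    module D = Category D
    module L = Functor L
    module G = Functor G
  open _⊣_ adj
  open IsFullyFaithful ff
  open Morphisms D
  open D.HomReasoning

  -- In `D` the splitting factors `G.F₁ h` through `G.F₁ q` as `G.F₁ h ∘ s`. This factor is a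
  -- homomorphism of comparison algebras, so fullness brings it back to `C`, and faithfulness brings
  -- back the equations.
  reflects-splitCoequalizer :
    ∀ {X Y Q} {f g : X C.⇒ Y} {q : Y C.⇒ Q} →
    IsSplitCoequalizer (G.F₁ f) (G.F₁ g) (G.F₁ q) → IsCoequalizer C f g q
  reflects-splitCoequalizer {X} {Y} {Q} {f} {g} {q} split = record
    { equality   = faithful (trans G.homomorphism (trans equality (sym G.homomorphism)))
    ; coequalize = λ h p → lift (hom h p)
    ; universal  = λ {Z} {h} p → faithful (trans G.homomorphism
        (trans (F₁-lift (hom h p) ⟩∘⟨refl) (factor (preserves-square G p))))
    ; unique     = λ {Z} {h} p {u} u∘q≈h → faithful
        (trans (splitEpi⇒epi q∘s≈id
          (trans (preserves-triangle G u∘q≈h) (sym (factor (preserves-square G p)))))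
          (sym (F₁-lift (hom h p))))
    }
    where
      open IsSplitCoequalizer split
      open D
      open D.Equiv
      module K = Functor (comparison adj)
      hom : ∀ {Z} (h : Y C.⇒ Z) → h C.∘ f C.≈ h C.∘ g →
            Category._⇒_ (EilenbergMoore (adjunctionMonad adj)) (K.F₀ Q) (K.F₀ Z)
      hom {Z} h p = record
        { arrow    = k
        -- The section `s` exists only in `D` and need not be a homomorphism. The square is checked
        -- after composing with `GL (G.F₁ q)`, a split epimorphism, where naturality of the counit
        -- at `q` and `h` suffices.
        ; commutes = splitEpi⇒epi (preserves-section (G ∘F L) q∘s≈id) (begin
            (k ∘ Gε Q) ∘ GL (G.F₁ q)    ≈⟨ pullʳ (preserves-square G (counit.commute q)) ⟩
            k ∘ (G.F₁ q ∘ Gε Y)         ≈⟨ pullˡ k∘Gq≈Gh ⟩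
            G.F₁ h ∘ Gε Y               ≈⟨ preserves-square G (counit.commute h) ⟨
            Gε Z ∘ GL (G.F₁ h)          ≈⟨ pullʳ (preserves-triangle (G ∘F L) k∘Gq≈Gh) ⟨
            (Gε Z ∘ GL k) ∘ GL (G.F₁ q) ∎)
        }
        where
          k = G.F₁ h ∘ s
          k∘Gq≈Gh : k ∘ G.F₁ q ≈ G.F₁ h
          k∘Gq≈Gh = factor (preserves-square G p)
          Gε : ∀ Y → G.F₀ (L.F₀ (G.F₀ Y)) ⇒ G.F₀ Y
          Gε Y = G.F₁ (counit.η Y)
          GL : ∀ {X Y} → X ⇒ Y → G.F₀ (L.F₀ X) ⇒ G.F₀ (L.F₀ Y)
          GL f = G.F₁ (L.F₁ f)

-- Quotients of `T`-algebras.

module _ {C : Category o ℓ e} (T : Functor C C) where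
  private module T = Functor T
  open Category C
  open Equiv
  open Morphisms C
  open HomReasoning
  open Algebra
  open AlgebraMorphism

  inverse-commutes : ∀ {A B : Algebra T} {f : carrier A ⇒ carrier B} {g : carrier B ⇒ carrier A} →
                     g ∘ f ≈ id → f ∘ g ≈ id →
                     f ∘ action A ≈ action B ∘ T.F₁ f → g ∘ action B ≈ action A ∘ T.F₁ g
  inverse-commutes {A} {B} {f} {g} g∘f≈id f∘g≈id p = begin
    g ∘ action B                              ≈⟨ cancelʳ (preserves-section T f∘g≈id) ⟨
    ((g ∘ action B) ∘ T.F₁ f) ∘ T.F₁ g        ≈⟨ extendˡ p ⟩∘⟨refl ⟨
    ((g ∘ f) ∘ action A) ∘ T.F₁ g             ≈⟨ trans (g∘f≈id ⟩∘⟨refl) identityˡ ⟩∘⟨refl ⟩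
    action A ∘ T.F₁ g                         ∎

  -- Composing with `T.F₁ (arrow q)` reduces the square for `f` to those of `q` and `m`; this is why
  -- `T.F₁ (arrow q)`, rather than `arrow q`, has to be an epimorphism.
  quotient-commutes : ∀ {P A B : Algebra T} (q : AlgebraMorphism T P A) (m : AlgebraMorphism T P B)
                      {f : carrier A ⇒ carrier B} → IsEpi (T.F₁ (arrow q)) →
                      f ∘ arrow q ≈ arrow m → f ∘ action A ≈ action B ∘ T.F₁ f
  quotient-commutes {P} {A} {B} q m {f} Tq-epi f∘q≈m = Tq-epi (begin
    (f ∘ action A) ∘ T.F₁ (arrow q)           ≈⟨ extendˡ (commutes q) ⟨
    (f ∘ arrow q) ∘ action P                  ≈⟨ f∘q≈m ⟩∘⟨refl ⟩
    arrow m ∘ action P                        ≈⟨ commutes m ⟩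
    action B ∘ T.F₁ (arrow m)                 ≈⟨ pullʳ (preserves-triangle T f∘q≈m) ⟨
    (action B ∘ T.F₁ f) ∘ T.F₁ (arrow q)      ∎)

  module _ {P Y : Algebra T} (f g : AlgebraMorphism T P Y) {Q : Obj} {q : carrier Y ⇒ Q}
           (c : IsCoequalizer C (arrow f) (arrow g) q)
           (Tc : IsCoequalizer C (T.F₁ (arrow f)) (T.F₁ (arrow g)) (T.F₁ q)) where
    private
      module Tc = IsCoequalizer Tc

      q∘action-equalizes : (q ∘ action Y) ∘ T.F₁ (arrow f) ≈ (q ∘ action Y) ∘ T.F₁ (arrow g)
      q∘action-equalizes = begin
        (q ∘ action Y) ∘ T.F₁ (arrow f)    ≈⟨ extendˡ (commutes f) ⟨
        (q ∘ arrow f) ∘ action P           ≈⟨ IsCoequalizer.equality c ⟩∘⟨refl ⟩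
        (q ∘ arrow g) ∘ action P           ≈⟨ extendˡ (commutes g) ⟩
        (q ∘ action Y) ∘ T.F₁ (arrow g)    ∎

    -- Since `f` and `g` are homomorphisms, `q ∘ action Y` equalizes their images under `T`, and so
    -- descends along the coequalizer `T.F₁ q`. The equation characterizing the descent says exactly
    -- that `q` is a homomorphism.
    coequalizerAlgebra : Algebra T
    coequalizerAlgebra = record
      { carrier = Q
      ; action  = Tc.coequalize (q ∘ action Y) q∘action-equalizes
      }

    coequalizerMorphism : AlgebraMorphism T Y coequalizerAlgebra
    coequalizerMorphism = record
      { arrow    = q
      ; commutes = sym (Tc.universal q∘action-equalizes)
      }

-- Composition of adjunctions.

module _ {o″ ℓ″ e″} {A : Category o″ ℓ″ e″} {C : Category o ℓ e} {D : Category o′ ℓ′ e′}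
         {F : Functor C A} {U : Functor A C} {L : Functor D C} {G : Functor C D}
         (F⊣U : F ⊣ U) (L⊣G : L ⊣ G) where
  private
    module A = Category A
    module C = Category C
    module F = Functor F
    module U = Functor U
    module L = Functor L
    module G = Functor G
    module FU = _⊣_ F⊣U
    module LG = _⊣_ L⊣G
    module MA = Morphisms A
    module MC = Morphisms C
  open Category D
  open Equiv
  open Morphisms D

  ∘-counit : ∀ B → F.F₀ (L.F₀ (G.F₀ (U.F₀ B))) A.⇒ B
  ∘-counit B = FU.counit.η B A.∘ F.F₁ (LG.counit.η (U.F₀ B))

  -- The composite counit is the transpose of `LG.counit` under `F ⊣ U`; this transposes it back.
  ∘-counit-unit : ∀ {B} → U.F₁ (∘-counit B) C.∘ FU.unit.η (L.F₀ (G.F₀ (U.F₀ B))) C.≈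
                  LG.counit.η (U.F₀ B)
  ∘-counit-unit {B} = begin
    U.F₁ (∘-counit B) C.∘ FU.unit.η _                           ≈⟨ U.homomorphism MC.⟩∘⟨refl ⟩
    (U.F₁ (FU.counit.η B) C.∘ U.F₁ (F.F₁ ε)) C.∘ FU.unit.η _    ≈⟨ MC.pullʳ (C.Equiv.sym (FU.unit.commute ε)) ⟩
    U.F₁ (FU.counit.η B) C.∘ (FU.unit.η (U.F₀ B) C.∘ ε)         ≈⟨ MC.cancelˡ FU.zag ⟩
    ε                                                           ∎
    where
      ε = LG.counit.η (U.F₀ B)
      open C.HomReasoning

  ∘-⊣ : (F ∘F L) ⊣ (G ∘F U)
  ∘-⊣ = record
    { unit   = record
      { η       = λ X → G.F₁ (FU.unit.η (L.F₀ X)) ∘ LG.unit.η X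
      ; commute = λ f → trans (pullʳ (LG.unit.commute f))
          (extendʳ (preserves-square G (FU.unit.commute (L.F₁ f))))
      }
    ; counit = record
      { η       = ∘-counit
      ; commute = λ f → A.Equiv.trans
          (MA.pullʳ (preserves-square F (LG.counit.commute (U.F₁ f))))
          (MA.extendʳ (FU.counit.commute f))
      }
    -- Naturality slides `LG.counit` past `FU.unit`. The triangle identity of `L ⊣ G` then cancels
    -- inside `F`, leaving the one of `F ⊣ U`.
    ; zig = λ {X} → A.Equiv.trans
        (MA.pullʳ (preserves-triangle F (C.Equiv.trans
          (C.∘-resp-≈ C.Equiv.refl L.homomorphism)
          (C.Equiv.trans (MC.extendʳ (LG.counit.commute (FU.unit.η (L.F₀ X))))
            (C.Equiv.trans (C.∘-resp-≈ C.Equiv.refl LG.zig) C.identityʳ)))))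
        FU.zig
    ; zag = trans (pullˡ (preserves-triangle G ∘-counit-unit)) LG.zag
    }

-- Restriction of algebras from the monad `R K` to the monad `G L`.

module _ {C : Category o ℓ e} {D : Category o′ ℓ′ e′} (T : Functor C C)
         {F : Functor C (Alg T)} (F⊣U : F ⊣ Forgetful T)
         (T-preserves : PreservesReflexiveCoequalizers T)
         {L : Functor D C} {G : Functor C D} (L⊣G : L ⊣ G) where
  private
    A = Alg T
    U = Forgetful T
    K = F ∘F L
    R = G ∘F U
    K⊣R : K ⊣ R
    K⊣R = ∘-⊣ F⊣U L⊣G
    module A = Category A
    module C = Category C
    module U = Functor U
    module T = Functor T
    module L = Functor L
    module G = Functor G
    module K = Functor K
    module R = Functor R
    module FU = _⊣_ F⊣U
    module LG = _⊣_ L⊣G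
    module KR = _⊣_ K⊣R
    module RK = Functor (R ∘F K)
    module MC = Morphisms C
    module ΦG = Functor (comparison L⊣G)
    EM-R = EilenbergMoore (adjunctionMonad K⊣R)
    EM-G = EilenbergMoore (adjunctionMonad L⊣G)
  open Category D
  open Equiv
  open Morphisms D
  open HomReasoning
  open Algebra
  open AlgebraMorphism

  private
    GL : ∀ {X Y} → X ⇒ Y → G.F₀ (L.F₀ X) ⇒ G.F₀ (L.F₀ Y)
    GL f = G.F₁ (L.F₁ f)

    RK : ∀ {X Y} → X ⇒ Y → R.F₀ (K.F₀ X) ⇒ R.F₀ (K.F₀ Y)
    RK f = R.F₁ (K.F₁ f)

    Gε : ∀ Y → G.F₀ (L.F₀ (G.F₀ Y)) ⇒ G.F₀ Y
    Gε Y = G.F₁ (LG.counit.η Y)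

    Rε : ∀ B → R.F₀ (K.F₀ (R.F₀ B)) ⇒ R.F₀ B
    Rε B = R.F₁ (KR.counit.η B)

    -- The components of a monad morphism from the monad G L to the monad R K.
    ι : ∀ X → G.F₀ (L.F₀ X) ⇒ R.F₀ (K.F₀ X)
    ι X = G.F₁ (FU.unit.η (L.F₀ X))

    ι-commute : ∀ {X Y} (f : X ⇒ Y) → ι Y ∘ GL f ≈ RK f ∘ ι X
    ι-commute f = preserves-square G (FU.unit.commute (L.F₁ f))

    -- Thus the comparison algebra of `B` for `R`, restricted along `ι`, is the comparison algebra
    -- of `U.F₀ B` for `G`.
    Rε∘ι≈Gε : ∀ {B} → Rε B ∘ ι (R.F₀ B) ≈ Gε (U.F₀ B)
    Rε∘ι≈Gε = preserves-triangle G (∘-counit-unit F⊣U L⊣G)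

  restrict : Category.Obj EM-R → Category.Obj EM-G
  restrict X = record
    { algebra  = record { carrier = X.carrier ; action = c }
    ; unitLaw  = trans assoc X.unitLaw
    ; assocLaw = begin
        c ∘ GL c                                           ≈⟨ pullʳ (ι-commute c) ⟩
        X.action ∘ (RK c ∘ ι _)                            ≈⟨ refl⟩∘⟨ RK.homomorphism ⟩∘⟨refl ⟩
        X.action ∘ ((RK X.action ∘ RK (ι _)) ∘ ι _)        ≈⟨ refl⟩∘⟨ assoc ⟩
        X.action ∘ (RK X.action ∘ (RK (ι _) ∘ ι _))        ≈⟨ extendʳ X.assocLaw ⟩
        -- The remaining steps show that `ι` respects the multiplications, by naturality of `ι` and
        -- then of `LG.counit` at the unit of `F ⊣ U`.
        X.action ∘ (Rε _ ∘ (RK (ι _) ∘ ι _))               ≈⟨ refl⟩∘⟨ refl⟩∘⟨ ι-commute (ι _) ⟨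
        X.action ∘ (Rε _ ∘ (ι _ ∘ GL (ι _)))               ≈⟨ refl⟩∘⟨ pullˡ Rε∘ι≈Gε ⟩
        X.action ∘ (Gε _ ∘ GL (ι _))                       ≈⟨ refl⟩∘⟨ preserves-square G (LG.counit.commute _) ⟩
        X.action ∘ (ι _ ∘ Gε′)                             ≈⟨ assoc ⟨
        c ∘ Gε′                                            ∎
    }
    where
      module X = EMAlgebra X
      c = X.action ∘ ι X.carrier
      Gε′ = G.F₁ (LG.counit.η (L.F₀ X.carrier))

  -- The comparison functor of the composite adjunction.

  module _ (ffG : IsFullyFaithful (comparison L⊣G)) where
    private module ffG = IsFullyFaithful ffG

    -- The presentation of `X` by free algebras, with a candidate quotient `q` in `C` whose image
    -- under `G` is the action up to `i`. Full faithfulness takes `i` to be the identity; essential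
    -- surjectivity takes it from a realization of the restricted algebra.
    module Canonical (X : Category.Obj EM-R) {Q : C.Obj} (i : Iso (G.F₀ Q) (EMAlgebra.carrier X))
                     {q : U.F₀ (K.F₀ (EMAlgebra.carrier X)) C.⇒ Q}
                     (i∘Gq≈a : Iso.to i ∘ G.F₁ q ≈ EMAlgebra.action X) where
      private
        module X = EMAlgebra X
        module i = Iso i
        ηX = KR.unit.η X.carrier

      Ka ε : K.F₀ (R.F₀ (K.F₀ X.carrier)) A.⇒ K.F₀ X.carrier
      Ka = K.F₁ X.action
      ε  = KR.counit.η (K.F₀ X.carrier)

      reflexivePair : IsReflexivePair C (U.F₁ Ka) (U.F₁ ε)
      reflexivePair = record
        { section  = U.F₁ (K.F₁ ηX)
        ; sectionˡ = preserves-section (U ∘F K) X.unitLaw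
        ; sectionʳ = preserves-section U {f = ε} {g = K.F₁ ηX} KR.zig
        }

      private
        Gq≈from∘a : G.F₁ q ≈ i.from ∘ X.action
        Gq≈from∘a = trans (sym (cancelˡ i.isoˡ)) (refl⟩∘⟨ i∘Gq≈a)

      -- This is Beck's split fork of an Eilenberg-Moore algebra, split by two components of the
      -- unit, with its vertex moved along `i`.
      split : IsSplitCoequalizer (R.F₁ Ka) (R.F₁ ε) (G.F₁ q)
      split = record
        { equality = trans (Gq≈from∘a ⟩∘⟨refl)
            (trans (extendˡ X.assocLaw) (sym Gq≈from∘a ⟩∘⟨refl))
        ; s        = ηX ∘ i.to
        ; t        = KR.unit.η (R.F₀ (K.F₀ X.carrier))
        ; q∘s≈id   = begin
            G.F₁ q ∘ (ηX ∘ i.to)                     ≈⟨ Gq≈from∘a ⟩∘⟨refl ⟩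
            (i.from ∘ X.action) ∘ (ηX ∘ i.to)        ≈⟨ assoc ⟩
            i.from ∘ (X.action ∘ (ηX ∘ i.to))        ≈⟨ refl⟩∘⟨ cancelˡ X.unitLaw ⟩
            i.from ∘ i.to                            ≈⟨ i.isoˡ ⟩
            id                                       ∎
        ; f∘t≈s∘q  = trans (sym (KR.unit.commute X.action)) (sym (pullʳ i∘Gq≈a))
        ; g∘t≈id   = KR.zag
        }

      coequalizer : IsCoequalizer C (U.F₁ Ka) (U.F₁ ε) q
      coequalizer = reflects-splitCoequalizer L⊣G ffG split

      T-coequalizer : IsCoequalizer C (T.F₁ (U.F₁ Ka)) (T.F₁ (U.F₁ ε)) (T.F₁ q)
      T-coequalizer = T-preserves reflexivePair coequalizer

    R-fullyFaithful : IsFullyFaithful (comparison K⊣R)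
    R-fullyFaithful = record
      -- Equality in `Alg T` is equality of underlying arrows, so the equations for `G` carry over
      -- unchanged.
      { faithful = ffG.faithful
      ; lift     = lift
      ; F₁-lift  = λ h → ffG.F₁-lift (restrictHom h)
      }
      where
        module ΦR = Functor (comparison K⊣R)

        restrictHom : ∀ {A B} → Category._⇒_ EM-R (ΦR.F₀ A) (ΦR.F₀ B) →
                      Category._⇒_ EM-G (ΦG.F₀ (U.F₀ A)) (ΦG.F₀ (U.F₀ B))
        restrictHom {A} {B} h = record
          { arrow    = arrow h
          ; commutes = begin
              arrow h ∘ Gε _                     ≈⟨ refl⟩∘⟨ Rε∘ι≈Gε ⟨
              arrow h ∘ (Rε A ∘ ι _)             ≈⟨ extendʳ (commutes h) ⟩
              Rε B ∘ (RK (arrow h) ∘ ι _)        ≈⟨ refl⟩∘⟨ ι-commute (arrow h) ⟨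
              Rε B ∘ (ι _ ∘ GL (arrow h))        ≈⟨ pullˡ Rε∘ι≈Gε ⟩
              Gε _ ∘ GL (arrow h)                ∎
          }

        lift : ∀ {A B} → Category._⇒_ EM-R (ΦR.F₀ A) (ΦR.F₀ B) → A A.⇒ B
        lift {A} {B} h = record
          { arrow    = f
          ; commutes = quotient-commutes T (KR.counit.η A) (KR.counit.η B A.∘ K.F₁ (arrow h))
              (MC.coequalizer⇒epi T-coequalizer)
              -- Under `G`, the factorization of the transpose of `arrow h` through the counit
              -- becomes the homomorphism law of `h`.
              (ffG.faithful (begin
                G.F₁ (f C.∘ U.F₁ (KR.counit.η A))               ≈⟨ G.homomorphism ⟩
                G.F₁ f ∘ Rε A                                   ≈⟨ ffG.F₁-lift (restrictHom h) ⟩∘⟨refl ⟩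
                arrow h ∘ Rε A                                  ≈⟨ commutes h ⟩
                Rε B ∘ RK (arrow h)                             ≈⟨ G.homomorphism ⟨
                R.F₁ (KR.counit.η B A.∘ K.F₁ (arrow h))         ∎))
          }
          where
            f = ffG.lift (restrictHom h)
            -- The action of a comparison algebra is already `R` of the counit, so the counit itself
            -- is the quotient.
            open Canonical (ΦR.F₀ A) Iso-refl {q = U.F₁ (KR.counit.η A)} identityˡ

    -- Realizing `restrict X` yields only an object of `C` and an isomorphism linear over `G L`. The
    -- `T`-structure and linearity over `R K` are both recovered from the quotient map `q`.
    R-splitEssentiallySurjective : IsSplitEssentiallySurjective (comparison L⊣G) →
                                   IsSplitEssentiallySurjective (comparison K⊣R)
    R-splitEssentiallySurjective esG = record { realize = algebra ; iso = algebraIso }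
      where
        open IsSplitEssentiallySurjective esG
        module _ (X : Category.Obj EM-R) where
          module X = EMAlgebra X
          module j = Morphisms.Iso (iso (restrict X))

          i : Iso (G.F₀ (realize (restrict X))) X.carrier
          i = record { to = arrow j.to ; from = arrow j.from ; isoˡ = j.isoˡ ; isoʳ = j.isoʳ }
          module i = Iso i

          -- Linearity over `G L` is the associativity law of `X` restricted along `ι`. It is what
          -- allows the action to be lifted to a morphism of `C`.
          actionHom : Category._⇒_ EM-G (ΦG.F₀ (U.F₀ (K.F₀ X.carrier))) (restrict X)
          actionHom = record
            { arrow    = X.action
            ; commutes = begin
                X.action ∘ Gε _                    ≈⟨ refl⟩∘⟨ Rε∘ι≈Gε ⟨
                X.action ∘ (Rε _ ∘ ι _)            ≈⟨ extendʳ X.assocLaw ⟨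
                X.action ∘ (RK X.action ∘ ι _)     ≈⟨ pullʳ (ι-commute X.action) ⟨
                (X.action ∘ ι _) ∘ GL X.action     ∎
            }

          quotientHom : Category._⇒_ EM-G (ΦG.F₀ (U.F₀ (K.F₀ X.carrier))) (ΦG.F₀ (realize (restrict X)))
          quotientHom = Category._∘_ EM-G
            {ΦG.F₀ (U.F₀ (K.F₀ X.carrier))} {restrict X} {ΦG.F₀ (realize (restrict X))}
            j.from actionHom

          i∘Gq≈a : i.to ∘ G.F₁ (ffG.lift quotientHom) ≈ X.action
          i∘Gq≈a = trans (refl⟩∘⟨ ffG.F₁-lift quotientHom) (cancelˡ i.isoʳ)

          open Canonical X i i∘Gq≈a

          algebra : Algebra T
          algebra = coequalizerAlgebra T Ka ε coequalizer T-coequalizer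

          q : K.F₀ X.carrier A.⇒ algebra
          q = coequalizerMorphism T Ka ε coequalizer T-coequalizer

          Rε-commute : Rε algebra ∘ RK (R.F₁ q) ≈ R.F₁ q ∘ Rε (K.F₀ X.carrier)
          Rε-commute = preserves-square R
            {f = KR.counit.η algebra} {g = K.F₁ (R.F₁ q)} {h = q} {k = ε} (KR.counit.commute q)

          -- As `R.F₁ q` is split in `D`, its image under `RK` is again a split epimorphism. After
          -- composing with it, naturality of the counit at `q` turns the claim into the
          -- associativity law of `X`.
          i-commutes : i.to ∘ Rε algebra ≈ X.action ∘ RK i.to
          i-commutes = splitEpi⇒epi (preserves-section (R ∘F K) (IsSplitCoequalizer.q∘s≈id split)) (begin
            (i.to ∘ Rε algebra) ∘ RK (R.F₁ q)        ≈⟨ pullʳ (Rε-commute) ⟩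
            i.to ∘ (R.F₁ q ∘ Rε _)                   ≈⟨ pullˡ i∘Gq≈a ⟩
            X.action ∘ Rε _                          ≈⟨ X.assocLaw ⟨
            X.action ∘ RK X.action                   ≈⟨ pullʳ (preserves-triangle (R ∘F K) i∘Gq≈a) ⟨
            (X.action ∘ RK i.to) ∘ RK (R.F₁ q)       ∎)

          algebraIso : Morphisms.Iso EM-R (Functor.F₀ (comparison K⊣R) algebra) X
          algebraIso = record
            { to   = record { arrow = i.to ; commutes = i-commutes }
            ; from = record
              { arrow    = i.from
              ; commutes = inverse-commutes (R ∘F K)
                  {EMAlgebra.algebra (Functor.F₀ (comparison K⊣R) algebra)} {X.algebra}
                  i.isoˡ i.isoʳ i-commutes
              }
            ; isoˡ = i.isoˡ
            ; isoʳ = i.isoʳ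
            }

theorem1p10 : ∀ {o ℓ e o′ ℓ′ e′} {C : Category o ℓ e} {D : Category o′ ℓ′ e′} →
    (T : Functor C C) → IsVarietor T → PreservesReflexiveCoequalizers T →
    (G : Functor C D) → IsMonadic G → IsMonadic (G ∘F Forgetful T)
theorem1p10 T (F , F⊣U) T-preserves G monadic = record
  { L             = F ∘F L
  ; L⊣R           = ∘-⊣ F⊣U L⊣R
  ; isEquivalence = fullyFaithful∧splitEssentiallySurjective⇒equivalence
      (R-fullyFaithful T F⊣U T-preserves L⊣R ff)
      (R-splitEssentiallySurjective T F⊣U T-preserves L⊣R ff
        (equivalence⇒splitEssentiallySurjective isEquivalence))
  }
  where
    open IsMonadic monadic
    ff = equivalence⇒fullyFaithful isEquivalence
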